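{- Let $n>k$ be positive integers and let $U$ be a unit interval order with $n+k$ elements. Then $$\#P^U_n\cdot\#P^U_k\ \ge\ \#P^U_{n+k}.$$
   Context: A unit interval order (UIO) $U$ is a finite subset of $\mathbb{R}$. For $a,b\in U$: $a\prec b$ (equivalently $b\succ a$) means $b\ge a+1$; $a\rightarrow b$ means $b>a-1$ (i.e. $a\succ b$ fails). A sequence $[w_1,\dots,w_m]$ of pairwise distinct elements of $U$ is an $m$-Escher if $w_1\rightarrow w_2\rightarrow\cdots\rightarrow w_m\rightarrow w_1$. $P^U_m$ denotes the set of $m$-Eschers in $U$.
   Formalization: The unit interval order U is taken to be a finite set of rational numbers instead of a finite set of real numbers. -}

module Defs where

open import Data.Nat using (ℕ; zero; suc)
open import Data.List using (List; []; _∷_; [_]; _++_; map; concatMap; filter; length)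
open import Data.Rational using (ℚ; 1ℚ; _-_; _<_)
open import Data.Rational.Properties using (_≟_; _<?_)
open import Data.List.Relation.Unary.Unique.Propositional using (Unique)
open import Data.List.Relation.Unary.Unique.DecPropositional _≟_ using (unique?)
open import Data.List.Relation.Unary.Linked using (Linked; linked?)
open import Data.Product using (_×_)
open import Relation.Nullary using (Dec; yes)
open import Relation.Nullary.Decidable using (_×-dec_)
open import Data.Unit using (⊤; tt)

record UIO : Set where
  field
    elems    : List ℚ
    distinct : Unique elems
open UIO public

-- a ≻ b  iff  a ≥ b + 1 ;  a → b  iff  not (a ≻ b)  iff  b > a - 1
_⟶_ : ℚ → ℚ → Set
a ⟶ b = (a - 1ℚ) < b

_⟶?_ : (a b : ℚ) → Dec (a ⟶ b)
a ⟶? b = (a - 1ℚ) <? b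

CyclicArrows : List ℚ → Set
CyclicArrows []       = ⊤
CyclicArrows (x ∷ xs) = Linked _⟶_ (x ∷ xs ++ [ x ])

cyclicArrows? : (w : List ℚ) → Dec (CyclicArrows w)
cyclicArrows? []       = yes tt
cyclicArrows? (x ∷ xs) = linked? _⟶?_ (x ∷ xs ++ [ x ])

IsEscher : List ℚ → Set
IsEscher w = Unique w × CyclicArrows w

isEscher? : (w : List ℚ) → Dec (IsEscher w)
isEscher? w = unique? w ×-dec cyclicArrows? w

words : List ℚ → ℕ → List (List ℚ)
words U zero    = [ [] ]
words U (suc m) = concatMap (λ u → map (u ∷_) (words U m)) U

P : UIO → ℕ → List (List ℚ)
P U m = filter isEscher? (words (elems U) m)

#P : UIO → ℕ → ℕ
#P U m = length (P U m)

{-# OPTIONS --safe #-}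

-- View an (n + k)-Escher as a sequence W of period N = n + k and put Z j = W (j + k).  Call j a
-- crossing of X and Y if X j ⟶ Y (1 + j) and Y j ⟶ X (1 + j).  Since X j ≻ Y (1 + j) and
-- X j ⟶ X (1 + j) force Y (1 + j) < X (1 + j), a run of non-crossings from 0 has one of the two
-- sequences above the other throughout.  For W and Z this cannot last, because the steps of k go
-- around the cycle; so there is a first crossing i.
--
-- At i the cycle can be cut into the k-Escher W (i + 1), …, W (i + k) and the n-Escher
-- W (i + k + 1), …, W (i + N).  Let V and U be the k- and n-periodic sequences agreeing with W
-- and Z right after i.  Periodicity carries the inequalities between W and Z below i over to V
-- and U, so that i is also the first crossing of U and V.  Hence i, and with it W, can be
-- recovered from U and V, that is, from U 0, …, U (n - 1) and V 0, …, V (k - 1).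
module Submission where

open import Defs
open import Data.Nat using (ℕ; _+_; _*_; _≤_; _<_)
open import Data.List using (length)
open import Relation.Binary.PropositionalEquality using (_≡_)

open import Data.Nat using (zero; suc; _∸_; _%_; _/_; z≤n; s≤s; z<s; s<s; s≤s⁻¹)
open import Data.Nat.Properties using
  ( +-assoc; +-comm; +-identityʳ; +-suc; ≤-refl; ≤-reflexive; ≤-trans; ≤-<-trans
  ; <⇒≤; <-cmp; m≤m+n; m≤n+m; m≤n⇒m≤1+n; m≤n⇒m<n∨m≡n; n<1+n; m<m+n; ≮⇒≥; _<?_
  ; +-monoˡ-≤; +-monoˡ-<; +-monoʳ-<; +-cancelˡ-≤; +-cancelʳ-≤; +-cancelʳ-<
  ; *-comm; +-mono-≤; +-cancelˡ-<; *-monoˡ-≤; m∸n+n≡m; m+[n∸m]≡n; m<n⇒0<n∸m; m∸n≤m; suc-injective )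
open import Data.Nat.DivMod using (m≡m%n+[m/n]*n; m%n<n; m<n⇒m%n≡m; [m+n]%n≡m%n; [m+kn]%n≡m%n)
open import Data.Nat.Solver using (module +-*-Solver)
open import Data.Fin using (Fin; zero; suc)
open import Data.Fin.Properties using (injective⇒≤)
open import Data.List using
  (List; []; _∷_; [_]; _++_; map; concatMap; lookup; applyUpTo; cartesianProduct; cartesianProductWith)
open import Data.List.Properties using (applyUpTo-∷ʳ; length-++; length-map; ∷-injective)
open import Data.List.Membership.Propositional using (_∈_)
open import Data.List.Membership.Propositional.Properties using
  ( ∈-lookup; ∈-filter⁺; ∈-filter⁻; ∈-cartesianProduct⁺
  ; ∈-cartesianProductWith⁺; ∈-cartesianProductWith⁻ )
open import Data.List.Membership.Setoid.Properties using (index-injective)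
open import Data.List.Relation.Unary.All as All using ([]; _∷_)
import Data.List.Relation.Unary.All.Properties as All
open import Data.List.Relation.Unary.AllPairs using ([]; _∷_)
open import Data.List.Relation.Unary.Any using (here; index)
open import Data.List.Relation.Unary.Linked using (Linked; _∷_)
import Data.List.Relation.Unary.Linked.Properties as Linked
open import Data.List.Relation.Unary.Unique.Propositional using (Unique)
import Data.List.Relation.Unary.Unique.Propositional.Properties as Unique
open import Data.Product using (∃-syntax; _×_; _,_; proj₁; proj₂)
open import Data.Rational as ℚ using (ℚ; 0ℚ)
import Data.Rational.Properties as ℚ
open import Data.Sum using (_⊎_; inj₁; inj₂)
open import Data.Empty using (⊥-elim)
open import Function using (_∘_; flip)
open import Relation.Binary.Core using (Rel)
open import Relation.Binary.Definitions using (Reflexive; Transitive; tri<; tri≈; tri>)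
open import Relation.Binary.PropositionalEquality
  using (_≢_; _≗_; refl; sym; trans; cong; cong₂; subst; subst₂; setoid; module ≡-Reasoning)
open import Relation.Nullary using (¬_; yes; no; contradiction)
open import Relation.Nullary.Decidable using (_×-dec_)
open import Relation.Unary using (Decidable)
open import Level using (0ℓ)

private variable
  A B : Set

-- Counting

lookup-injective : {xs : List A} → Unique xs → {i j : Fin (length xs)} →
  lookup xs i ≡ lookup xs j → i ≡ j
lookup-injective (_ ∷ _) {zero} {zero} _ = refl
lookup-injective {xs = _ ∷ xs} (x∉ ∷ _) {zero} {suc j} eq =
  contradiction eq (All.lookup x∉ (∈-lookup j))
lookup-injective {xs = _ ∷ xs} (x∉ ∷ _) {suc i} {zero} eq =
  contradiction (sym eq) (All.lookup x∉ (∈-lookup i))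
lookup-injective (_ ∷ uniq) {suc i} {suc j} eq = cong suc (lookup-injective uniq eq)

-- Choosing a related entry for each position of `xs` maps positions to positions. Equal images
-- force equal entries, hence equal positions by uniqueness. With a relation, the recovery of `x`
-- from `y` may use all the data hidden in `R x y`.
length-mono-relation : (R : A → B → Set) {xs : List A} {ys : List B} → Unique xs →
  (∀ {x} → x ∈ xs → ∃[ y ] y ∈ ys × R x y) →
  (∀ {x x′ y} → R x y → R x′ y → x ≡ x′) →
  length xs ≤ length ys
length-mono-relation R {xs} {ys} uniq total injective =
  injective⇒≤ {f = position} position-injective
  where
  image : ∀ i → ∃[ y ] y ∈ ys × R (lookup xs i) y
  image i = total (∈-lookup i)

  position : Fin (length xs) → Fin (length ys)
  position i = index (proj₁ (proj₂ (image i)))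

  position-injective : ∀ {i j} → position i ≡ position j → i ≡ j
  position-injective {i} {j} eq = lookup-injective uniq
    (injective (proj₂ (proj₂ (image i)))
      (subst (R (lookup xs j))
        (sym (index-injective (setoid _) (proj₁ (proj₂ (image i))) (proj₁ (proj₂ (image j))) eq))
        (proj₂ (proj₂ (image j)))))

length-cartesianProduct : (xs : List A) (ys : List B) →
  length (cartesianProduct xs ys) ≡ length xs * length ys
length-cartesianProduct []       ys = refl
length-cartesianProduct (x ∷ xs) ys = trans (length-++ (map (x ,_) ys))
  (cong₂ _+_ (length-map (x ,_) ys) (length-cartesianProduct xs ys))

first-witness : {Q : ℕ → Set} → Decidable Q → ∀ B →
  (∃[ i ] Q i × (∀ {j} → j < i → ¬ Q j)) ⊎ (∀ {j} → j < B → ¬ Q j)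
first-witness Q? zero = inj₂ λ ()
first-witness {Q} Q? (suc B) with first-witness Q? B
... | inj₁ found = inj₁ found
... | inj₂ none with Q? B
...   | yes QB = inj₁ (B , QB , none)
...   | no ¬QB = inj₂ none′
  where
  none′ : ∀ {j} → j < suc B → ¬ Q j
  none′ j<1+B with m≤n⇒m<n∨m≡n (s≤s⁻¹ j<1+B)
  ... | inj₁ j<B  = none j<B
  ... | inj₂ refl = ¬QB

-- Words as finite sequences

concatMap-map≡cartesianProductWith : {C : Set} (f : A → B → C) (xs : List A) (ys : List B) →
  concatMap (λ x → map (f x) ys) xs ≡ cartesianProductWith f xs ys
concatMap-map≡cartesianProductWith f [] ys = refl
concatMap-map≡cartesianProductWith f (x ∷ xs) ys =
  cong (map (f x) ys ++_) (concatMap-map≡cartesianProductWith f xs ys)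

words-suc : ∀ E m → words E (suc m) ≡ cartesianProductWith _∷_ E (words E m)
words-suc E m = concatMap-map≡cartesianProductWith _∷_ E (words E m)

words-unique : ∀ {E} → Unique E → ∀ m → Unique (words E m)
words-unique uniq zero = [] ∷ []
words-unique {E} uniq (suc m) = subst Unique (sym (words-suc E m))
  (Unique.cartesianProductWith⁺ _∷_ ∷-injective uniq (words-unique uniq m))

applyUpTo∈words : ∀ {E} (f : ℕ → ℚ) → (∀ j → f j ∈ E) → ∀ m → applyUpTo f m ∈ words E m
applyUpTo∈words f f∈E zero = here refl
applyUpTo∈words {E} f f∈E (suc m) = subst (_ ∈_) (sym (words-suc E m))
  (∈-cartesianProductWith⁺ _∷_ (f∈E 0) (applyUpTo∈words (f ∘ suc) (f∈E ∘ suc) m))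

word⇒applyUpTo : ∀ {E} m {w} → w ∈ words E m →
  ∃[ f ] (∀ {j} → j < m → f j ∈ E) × w ≡ applyUpTo f m
-- Beyond the word the values are arbitrary, here `0ℚ`; hence membership in `E` is claimed only
-- below `m`.
word⇒applyUpTo zero (here refl) = (λ _ → 0ℚ) , (λ ()) , refl
word⇒applyUpTo {E} (suc m) w∈
  with u , v , u∈E , v∈ , refl ←
         ∈-cartesianProductWith⁻ _∷_ E (words E m) (subst (_ ∈_) (words-suc E m) w∈)
  with f , f∈E , refl ← word⇒applyUpTo m v∈ = f′ , f′∈E , refl
  where
  f′ : ℕ → ℚ
  f′ zero    = u
  f′ (suc j) = f j

  f′∈E : ∀ {j} → j < suc m → f′ j ∈ E
  f′∈E {zero}  _         = u∈E
  f′∈E {suc j} (s<s j<m) = f∈E j<m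

applyUpTo-cong : ∀ {f g : ℕ → A} m → (∀ {j} → j < m → f j ≡ g j) →
  applyUpTo f m ≡ applyUpTo g m
applyUpTo-cong zero    f≡g = refl
applyUpTo-cong (suc m) f≡g = cong₂ _∷_ (f≡g z<s) (applyUpTo-cong m (f≡g ∘ s<s))

applyUpTo-injective : ∀ (f g : ℕ → A) m → applyUpTo f m ≡ applyUpTo g m →
  ∀ {j} → j < m → f j ≡ g j
applyUpTo-injective f g (suc m) eq {zero}  _         = proj₁ (∷-injective eq)
applyUpTo-injective f g (suc m) eq {suc j} (s<s j<m) =
  applyUpTo-injective (f ∘ suc) (g ∘ suc) m (proj₂ (∷-injective eq)) j<m

applyUpTo-unique⁻ : ∀ (f : ℕ → A) m → Unique (applyUpTo f m) →
  ∀ {i j} → i < j → j < m → f i ≢ f j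
applyUpTo-unique⁻ f (suc m) (f0∉ ∷ _)  {zero}  {suc j} _ (s<s j<m) =
  All.applyUpTo⁻ (f ∘ suc) m f0∉ j<m
applyUpTo-unique⁻ f (suc m) (_ ∷ uniq) {suc i} {suc j} (s<s i<j) (s<s j<m) =
  applyUpTo-unique⁻ (f ∘ suc) m uniq i<j j<m

applyUpTo-linked⁻ : {R : Rel A 0ℓ} (f : ℕ → A) → ∀ m → Linked R (applyUpTo f m) →
  ∀ {j} → suc j < m → R (f j) (f (suc j))
applyUpTo-linked⁻ f (suc zero)    _        (s<s ())
applyUpTo-linked⁻ f (suc (suc m)) (r ∷ _)  {zero}  _         = r
applyUpTo-linked⁻ f (suc (suc m)) (_ ∷ rs) {suc j} (s<s j<m) =
  applyUpTo-linked⁻ (f ∘ suc) (suc m) rs j<m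

-- Periodic sequences

Periodic : (ℕ → A) → ℕ → Set
Periodic f m = ∀ j → f (j + m) ≡ f j

-- Subtracting b modulo m is done by adding b * (m - 1).
representative : ∀ b m′ j → ℕ
representative b m′ j = b + (j + b * m′) % suc m′

representative-lower : ∀ b m′ j → b ≤ representative b m′ j
representative-lower b m′ j = m≤m+n b _

representative-upper : ∀ b m′ j → representative b m′ j < b + suc m′
representative-upper b m′ j = +-monoʳ-< b (m%n<n (j + b * m′) (suc m′))

representative-+ : ∀ b m′ j → representative b m′ (j + suc m′) ≡ representative b m′ j
representative-+ b m′ j = cong (b +_) (trans
  (cong (_% suc m′) (solve 3 (λ j b m → j :+ m :+ b := j :+ b :+ m) refl j (b * m′) (suc m′)))
  ([m+n]%n≡m%n (j + b * m′) (suc m′)))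
  where open +-*-Solver

representative-window : ∀ b m′ {j} → b ≤ j → j < b + suc m′ → representative b m′ j ≡ j
representative-window b m′ {j} b≤j j<b+m = begin
  b + (j + b * m′) % suc m′           ≡⟨ cong (λ x → b + (x + b * m′) % suc m′) (m+[n∸m]≡n b≤j) ⟨
  b + (b + d + b * m′) % suc m′       ≡⟨ cong (λ x → b + x % suc m′)
                                           (solve 3 (λ b d m → b :+ d :+ b :* m
                                                           := d :+ b :* (con 1 :+ m)) refl b d m′) ⟩
  b + (d + b * suc m′) % suc m′       ≡⟨ cong (b +_) ([m+kn]%n≡m%n d b (suc m′)) ⟩
  b + d % suc m′                      ≡⟨ cong (b +_) (m<n⇒m%n≡m d<m) ⟩
  b + d                               ≡⟨ m+[n∸m]≡n b≤j ⟩
  j                                   ∎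
  where
  open ≡-Reasoning
  open +-*-Solver
  d = j ∸ b
  d<m : d < suc m′
  d<m = +-cancelˡ-≤ b _ _ (subst (_≤ b + suc m′)
    (trans (cong suc (sym (m+[n∸m]≡n b≤j))) (sym (+-suc b d))) j<b+m)

representative-shift : ∀ b m′ j →
  j + b * suc m′ ≡ representative b m′ j + (j + b * m′) / suc m′ * suc m′
representative-shift b m′ j = begin
  j + b * suc m′             ≡⟨ solve 3 (λ j b m → j :+ b :* (con 1 :+ m) := b :+ (j :+ b :* m))
                                  refl j b m′ ⟩
  b + x                      ≡⟨ cong (b +_) (m≡m%n+[m/n]*n x (suc m′)) ⟩
  b + (x % suc m′ + x / suc m′ * suc m′) ≡⟨ +-assoc b _ _ ⟨
  representative b m′ j + x / suc m′ * suc m′ ∎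
  where
  open ≡-Reasoning
  open +-*-Solver
  x = j + b * m′

-- From the representative of `j` in the window, `up` climbs to `j + b * suc m′`, and `down` then
-- descends `b` periods to `j`, which may lie below the window.
window⇒everywhere : {Q : ℕ → Set} → ∀ b m′ →
  (∀ {j} → Q j → Q (j + suc m′)) → (∀ {j} → Q (j + suc m′) → Q j) →
  (∀ {j} → b ≤ j → j < b + suc m′ → Q j) → ∀ j → Q j
window⇒everywhere {Q} b m′ up down window j =
  down* b (subst Q (sym (representative-shift b m′ j))
    (up* ((j + b * m′) / suc m′)
      (window (representative-lower b m′ j) (representative-upper b m′ j))))
  where
  next : ∀ j q → j + suc m′ + q * suc m′ ≡ j + suc q * suc m′
  next j q = +-assoc j (suc m′) (q * suc m′)

  up* : ∀ {j} q → Q j → Q (j + q * suc m′)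
  up* {j} zero    Qj = subst Q (sym (+-identityʳ j)) Qj
  up* {j} (suc q) Qj = subst Q (next j q) (up* q (up Qj))

  down* : ∀ {j} q → Q (j + q * suc m′) → Q j
  down* {j} zero    Qj = subst Q (+-identityʳ j) Qj
  down* {j} (suc q) Qj = down (down* q (subst Q (sym (next j q)) Qj))

periodic-≗ : ∀ {f g : ℕ → A} b m′ → Periodic f (suc m′) → Periodic g (suc m′) →
  (∀ {j} → b ≤ j → j < b + suc m′ → f j ≡ g j) → f ≗ g
periodic-≗ b m′ f-per g-per = window⇒everywhere b m′
  (λ {j} eq → trans (f-per j) (trans eq (sym (g-per j))))
  (λ {j} eq → trans (sym (f-per j)) (trans eq (g-per j)))

periodize : ∀ b m′ → (ℕ → A) → ℕ → A
periodize b m′ f j = f (representative b m′ j)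

periodize-periodic : ∀ b m′ (f : ℕ → A) → Periodic (periodize b m′ f) (suc m′)
periodize-periodic b m′ f j = cong f (representative-+ b m′ j)

periodize-window : ∀ b m′ (f : ℕ → A) {j} → b ≤ j → j < b + suc m′ → periodize b m′ f j ≡ f j
periodize-window b m′ f b≤j j<b+m = cong f (representative-window b m′ b≤j j<b+m)

-- Eschers as periodic sequences

-- Phrasing distinctness by the distance `d` makes it invariant under shifts: any `m` consecutive
-- values are distinct.
record EscherSequence (f : ℕ → ℚ) (m : ℕ) : Set where
  field
    periodic : Periodic f m
    arrows   : ∀ j → f j ⟶ f (suc j)
    separate : ∀ a {d} → 0 < d → d < m → f a ≢ f (a + d)
open EscherSequence

periodize-escher : ∀ b m′ (f : ℕ → ℚ) →
  (∀ {j} → b ≤ j → suc j < b + suc m′ → f j ⟶ f (suc j)) →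
  f (b + m′) ⟶ f b →
  (∀ {a c} → b ≤ a → a < c → c < b + suc m′ → f a ≢ f c) →
  EscherSequence (periodize b m′ f) (suc m′)
periodize-escher b m′ f f-arrows f-wrap f-separate = record
  { periodic = g-periodic ; arrows = g-arrows ; separate = g-separate }
  where
  m = suc m′
  g = periodize b m′ f
  g-periodic : Periodic g m
  g-periodic = periodize-periodic b m′ f

  g-window : ∀ {j} → b ≤ j → j < b + m → g j ≡ f j
  g-window = periodize-window b m′ f

  g-arrows : ∀ j → g j ⟶ g (suc j)
  g-arrows = window⇒everywhere b m′
    (λ {j} → subst₂ _⟶_ (sym (g-periodic j)) (sym (g-periodic (suc j))))
    (λ {j} → subst₂ _⟶_ (g-periodic j) (g-periodic (suc j)))
    window
    where
    window : ∀ {j} → b ≤ j → j < b + m → g j ⟶ g (suc j)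
    window {j} b≤j j<b+m with m≤n⇒m<n∨m≡n j<b+m
    ... | inj₁ 1+j<b+m = subst₂ _⟶_
      (sym (g-window b≤j j<b+m)) (sym (g-window (m≤n⇒m≤1+n b≤j) 1+j<b+m))
      (f-arrows b≤j 1+j<b+m)
    -- After the last position of the window, periodicity returns to the value at `b`: this is the
    -- wrap-around arrow.
    ... | inj₂ 1+j≡b+m = subst₂ _⟶_
      (trans (cong f (sym j≡b+m′)) (sym (g-window b≤j j<b+m)))
      (trans (sym (g-window ≤-refl (m<m+n b z<s)))
        (trans (sym (g-periodic b)) (cong g (sym 1+j≡b+m))))
      f-wrap
      where
      j≡b+m′ : j ≡ b + m′
      j≡b+m′ = suc-injective (trans 1+j≡b+m (+-suc b m′))

  g-separate : ∀ a {d} → 0 < d → d < m → g a ≢ g (a + d)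
  g-separate = window⇒everywhere {Q = λ a → ∀ {d} → 0 < d → d < m → g a ≢ g (a + d)} b m′
    (λ {a} sep {d} 0<d d<m eq → sep 0<d d<m
      (trans (sym (g-periodic a)) (trans eq (shift a d))))
    (λ {a} sep {d} 0<d d<m eq → sep 0<d d<m
      (trans (g-periodic a) (trans eq (sym (shift a d)))))
    window
    where
    shift : ∀ a d → g (a + m + d) ≡ g (a + d)
    shift a d = trans (cong g (solve 3 (λ a m d → a :+ m :+ d := a :+ d :+ m) refl a m d))
      (g-periodic (a + d))
      where open +-*-Solver

    window : ∀ {a} → b ≤ a → a < b + m → ∀ {d} → 0 < d → d < m → g a ≢ g (a + d)
    window {a} b≤a a<b+m {d} 0<d d<m eq with a + d <? b + m
    ... | yes a+d<b+m = f-separate b≤a (m<m+n a 0<d) a+d<b+m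
      (trans (sym (g-window b≤a a<b+m))
        (trans eq (g-window (≤-trans b≤a (m≤m+n a d)) a+d<b+m)))
    -- `a + d` has left the window; one period earlier it is `c`, still in the window, and below `a`
    -- because `d < m`.
    ... | no  a+d≮b+m = f-separate b≤c c<a a<b+m
      (trans (sym (g-window b≤c (≤-<-trans (<⇒≤ c<a) a<b+m)))
        (trans (sym (g-periodic c)) (trans (cong g c+m≡a+d)
          (trans (sym eq) (g-window b≤a a<b+m)))))
      where
      b+m≤a+d = ≮⇒≥ a+d≮b+m
      c = a + d ∸ m
      c+m≡a+d : c + m ≡ a + d
      c+m≡a+d = m∸n+n≡m (≤-trans (m≤n+m m b) b+m≤a+d)
      b≤c : b ≤ c
      b≤c = +-cancelʳ-≤ m b c (subst (b + m ≤_) (sym c+m≡a+d) b+m≤a+d)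
      c<a : c < a
      c<a = +-cancelʳ-< m c a (subst (_< a + m) (sym c+m≡a+d) (+-monoʳ-< a d<m))

escher⇒sequence : ∀ m′ (f : ℕ → ℚ) → IsEscher (applyUpTo f (suc m′)) →
  EscherSequence (periodize 0 m′ f) (suc m′)
escher⇒sequence m′ f (uniq , linked) = periodize-escher 0 m′ f
  (λ {j} _ 1+j<m → subst₂ _⟶_ (h≡f (<⇒≤ 1+j<m)) (h≡f 1+j<m) (h-arrows (m≤n⇒m≤1+n 1+j<m)))
  (subst₂ _⟶_ (h≡f (n<1+n m′)) h-end (h-arrows (n<1+n (suc m′))))
  (λ _ → applyUpTo-unique⁻ f (suc m′) uniq)
  where
  h = periodize 0 m′ f
  h≡f : ∀ {j} → j < suc m′ → h j ≡ f j
  h≡f = periodize-window 0 m′ f z≤n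

  h-end : h (suc m′) ≡ f 0
  h-end = trans (periodize-periodic 0 m′ f 0) (h≡f z<s)

  -- The last link of the closed word is the wrap-around arrow. It is read in `h`, since `f` is
  -- unconstrained at `suc m′`.
  closed : applyUpTo f (suc m′) ++ [ f 0 ] ≡ applyUpTo h (suc (suc m′))
  closed = trans
    (cong₂ (λ xs x → xs ++ [ x ]) (applyUpTo-cong (suc m′) (λ j<m → sym (h≡f j<m))) (sym h-end))
    (applyUpTo-∷ʳ h (suc m′))

  h-arrows : ∀ {j} → suc j < suc (suc m′) → h j ⟶ h (suc j)
  h-arrows = applyUpTo-linked⁻ h (suc (suc m′)) (subst (Linked _⟶_) closed linked)

sequence⇒escher : ∀ m′ {f} → EscherSequence f (suc m′) → IsEscher (applyUpTo f (suc m′))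
sequence⇒escher m′ {f} esc = uniq , linked
  where
  uniq : Unique (applyUpTo f (suc m′))
  uniq = Unique.applyUpTo⁺₁ f (suc m′) λ {i} {j} i<j j<m eq →
    separate esc i (m<n⇒0<n∸m i<j) (≤-<-trans (m∸n≤m j i) j<m)
      (trans eq (cong f (sym (m+[n∸m]≡n (<⇒≤ i<j)))))

  linked : CyclicArrows (applyUpTo f (suc m′))
  linked = subst (Linked _⟶_)
    (trans (sym (applyUpTo-∷ʳ f (suc m′)))
      (cong (λ x → applyUpTo f (suc m′) ++ [ x ]) (periodic esc 0)))
    (Linked.applyUpTo⁺₂ f (suc (suc m′)) (arrows esc))

-- Crossings

⟶-mono : ∀ {a a′ b b′} → a ℚ.≤ a′ → a′ ⟶ b′ → b′ ℚ.≤ b → a ⟶ b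
⟶-mono a≤a′ a′⟶b′ b′≤b = ℚ.≤-<-trans (ℚ.+-monoˡ-≤ _ a≤a′) (ℚ.<-≤-trans a′⟶b′ b′≤b)

Crossing : (X Y : ℕ → ℚ) → ℕ → Set
Crossing X Y j = X j ⟶ Y (suc j) × Y j ⟶ X (suc j)

crossing? : ∀ X Y → Decidable (Crossing X Y)
crossing? X Y j = (X j ⟶? Y (suc j)) ×-dec (Y j ⟶? X (suc j))

-- The inequality is taken at `suc j`; at `0` the sequence `X` need not be above `Y`.
Dominates : (X Y : ℕ → ℚ) → ℕ → Set
Dominates X Y i = ∀ {j} → j < i → ¬ (X j ⟶ Y (suc j)) × Y (suc j) ℚ.< X (suc j)

module _ (X Y : ℕ → ℚ) (X-arrows : ∀ j → X j ⟶ X (suc j)) where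

  overtakes : ∀ j → ¬ (X j ⟶ Y (suc j)) → Y (suc j) ℚ.< X (suc j)
  overtakes j X≻Y = ℚ.≤-<-trans (ℚ.≮⇒≥ X≻Y) (X-arrows j)

  -- The failure of the arrow propagates: once `Y (suc j)` is below `X (suc j)`, the arrow leaving
  -- `X (suc j)` inside `X` also leaves `Y (suc j)`, so an arrow `X (suc j) ⟶ Y (suc (suc j))` would
  -- complete a crossing.
  dominates : ∀ {i} → (∀ {j} → j < i → ¬ Crossing X Y j) → ¬ (X 0 ⟶ Y 1) → Dominates X Y i
  dominates {i} none start j<i = blocked _ j<i , overtakes _ (blocked _ j<i)
    where
    blocked : ∀ j → j < i → ¬ (X j ⟶ Y (suc j))
    blocked zero    _     = start
    blocked (suc j) 1+j<i X⟶Y = none 1+j<i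
      (X⟶Y , ⟶-mono (ℚ.<⇒≤ (overtakes j (blocked j (<⇒≤ 1+j<i)))) (X-arrows (suc j)) ℚ.≤-refl)

-- If `0` is not a crossing, one of its two arrows fails, and the sequence in which that arrow
-- starts dominates.
dominates-either : ∀ X Y →
  (∀ j → X j ⟶ X (suc j)) → (∀ j → Y j ⟶ Y (suc j)) →
  ∀ i → (∀ {j} → j < i → ¬ Crossing X Y j) → Dominates X Y i ⊎ Dominates Y X i
dominates-either X Y X-arrows Y-arrows zero none = inj₁ λ ()
dominates-either X Y X-arrows Y-arrows (suc i) none with X 0 ⟶? Y 1
... | no  X≻Y = inj₁ (dominates X Y X-arrows none X≻Y)
... | yes X⟶Y = inj₂ (dominates Y X Y-arrows (λ j<i (p , q) → none j<i (q , p))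
                        (λ Y⟶X → none z<s (X⟶Y , Y⟶X)))

-- Going around the cycle W (1), W (1 + k), W (1 + 2k), … returns to W (1) after N steps.
chain-impossible : (_<′_ : Rel ℚ 0ℓ) → Transitive _<′_ → (∀ {x} → ¬ (x <′ x)) →
  ∀ {W N′} k → Periodic W (suc N′) →
  ¬ (∀ {j} → j < suc (suc N′ * k) → W (suc j + k) <′ W (suc j))
chain-impossible _<′_ <′-trans <′-irrefl {W} {N′} k periodic descends =
  <′-irrefl (subst (_<′ W 1) return (chain N′ ≤-refl))
  where
  chain : ∀ m → m ≤ N′ → W (suc (suc m * k)) <′ W 1
  chain zero _ = subst (λ x → W (suc x) <′ W 1) (sym (+-identityʳ k)) (descends z<s)
  chain (suc m) m<N′ = <′-trans
    (subst (λ x → W (suc x) <′ W (suc (suc m * k))) (+-comm (suc m * k) k)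
      (descends (s≤s (*-monoˡ-≤ k (m≤n⇒m≤1+n m<N′)))))
    (chain m (<⇒≤ m<N′))

  wind : ∀ q → W (suc (q * suc N′)) ≡ W 1
  wind zero = refl
  wind (suc q) = trans (cong (W ∘ suc) (+-comm (suc N′) (q * suc N′)))
    (trans (periodic (suc (q * suc N′))) (wind q))

  return : W (suc (suc N′ * k)) ≡ W 1
  return = trans (cong (W ∘ suc) (*-comm (suc N′) k)) (wind k)

-- Write `m` for `suc m′`. If `i < j + m`, then `j + m` is in the window and `g j` equals
-- `f (j + m)`. Otherwise induction bounds `g (j + m)` by `f (j + m + m)`, and `descends` bounds
-- that by `f (j + m)`.
periodic-comparison : (_≤′_ : Rel ℚ 0ℓ) → Reflexive _≤′_ → Transitive _≤′_ →
  ∀ (f g : ℕ → ℚ) i m′ → Periodic g (suc m′) →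
  (∀ {j} → suc i ≤ j → j < suc i + suc m′ → g j ≡ f j) →
  (∀ {j} → j < i → f (suc j + suc m′) ≤′ f (suc j)) →
  ∀ {j} → j ≤ i → g j ≤′ f (j + suc m′)
periodic-comparison _≤′_ ≤′-refl ≤′-trans f g i m′ g-periodic window descends {j} j≤i =
  go i j≤i (s≤s (m≤n+m i j))
  where
  m = suc m′
  -- `t` bounds the distance from `j` up to `i`, which each step lowers by `m`, so by at least one.
  go : ∀ t {j} → j ≤ i → i < suc (j + t) → g j ≤′ f (j + m)
  go t {j} j≤i i<1+j+t with i <? j + m
  ... | yes i<j+m = subst (_≤′ f (j + m))
    (trans (sym (window i<j+m (s≤s (+-monoˡ-≤ m j≤i)))) (g-periodic j)) ≤′-refl
  go zero {j} j≤i i<1+j+t | no i≮j+m = contradiction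
    (≤-<-trans (s≤s⁻¹ (subst (λ x → i < suc x) (+-identityʳ j) i<1+j+t)) (m<m+n j z<s)) i≮j+m
  go (suc t) {j} j≤i i<1+j+t | no i≮j+m = subst (_≤′ f (j + m)) (g-periodic j)
    (≤′-trans
      (go t j+m≤i (≤-trans i<1+j+t
        (s≤s (≤-trans (≤-reflexive (+-suc j t))
          (+-monoˡ-≤ t (≤-trans (s≤s (m≤m+n j m′)) (≤-reflexive (sym (+-suc j m′)))))))))
      (subst (λ x → f (x + m) ≤′ f x) (sym (+-suc j m′))
        (descends (subst (_≤ i) (+-suc j m′) j+m≤i))))
    where
    j+m≤i : j + m ≤ i
    j+m≤i = ≮⇒≥ i≮j+m

-- Splitting an (n + k)-Escher, with n = suc n′ and k = suc k′

-- `crosses` and `first` mention only `U` and `V`, so that these determine `i`. After `i`, the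
-- window of `U` holds the entries of `W` that follow those in the window of `V`.
record Splitting (n′ k′ : ℕ) (w u v : List ℚ) : Set where
  field
    {W U V}    : ℕ → ℚ
    i          : ℕ
    w≡         : w ≡ applyUpTo W (suc n′ + suc k′)
    u≡         : u ≡ applyUpTo U (suc n′)
    v≡         : v ≡ applyUpTo V (suc k′)
    W-periodic : Periodic W (suc n′ + suc k′)
    U-periodic : Periodic U (suc n′)
    V-periodic : Periodic V (suc k′)
    U-window   : ∀ {j} → suc i ≤ j → j < suc i + suc n′ → U j ≡ W (j + suc k′)
    V-window   : ∀ {j} → suc i ≤ j → j < suc i + suc k′ → V j ≡ W j
    crosses    : Crossing U V i
    first      : ∀ {j} → j < i → ¬ Crossing U V j

-- `u` and `v` hold full periods, which fixes `U` and `V`, then `i` as their first crossing. The two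
-- windows together fill a full period of `W`.
splitting-injective : ∀ {n′ k′ w w′ u v} →
  Splitting n′ k′ w u v → Splitting n′ k′ w′ u v → w ≡ w′
splitting-injective {n′} {k′} s s′ =
  trans S.w≡ (trans (applyUpTo-cong (suc n′ + suc k′) (λ {j} _ → W≗ j)) (sym S′.w≡))
  where
  module S  = Splitting s
  module S′ = Splitting s′

  U≗ : S.U ≗ S′.U
  U≗ = periodic-≗ 0 n′ S.U-periodic S′.U-periodic
    (λ _ → applyUpTo-injective S.U S′.U (suc n′) (trans (sym S.u≡) S′.u≡))

  V≗ : S.V ≗ S′.V
  V≗ = periodic-≗ 0 k′ S.V-periodic S′.V-periodic
    (λ _ → applyUpTo-injective S.V S′.V (suc k′) (trans (sym S.v≡) S′.v≡))

  i≡ : S.i ≡ S′.i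
  i≡ with <-cmp S.i S′.i
  ... | tri≈ _ eq _ = eq
  ... | tri< i<i′ _ _ = contradiction
    (subst₂ _⟶_ (U≗ _) (V≗ _) (proj₁ S.crosses) , subst₂ _⟶_ (V≗ _) (U≗ _) (proj₂ S.crosses))
    (S′.first i<i′)
  ... | tri> _ _ i′<i = contradiction
    ( subst₂ _⟶_ (sym (U≗ _)) (sym (V≗ _)) (proj₁ S′.crosses)
    , subst₂ _⟶_ (sym (V≗ _)) (sym (U≗ _)) (proj₂ S′.crosses))
    (S.first i′<i)

  window : ∀ {j} → suc S.i ≤ j → j < suc S.i + (suc n′ + suc k′) → S.W j ≡ S′.W j
  window {j} i<j j<i+N with j <? suc S.i + suc k′
  ... | yes j<i+k = trans (sym (S.V-window i<j j<i+k)) (trans (V≗ j)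
    (S′.V-window (subst (λ i → suc i ≤ j) i≡ i<j) (subst (λ i → j < suc i + suc k′) i≡ j<i+k)))
  ... | no  j≮i+k = subst (λ j → S.W j ≡ S′.W j) l+k≡j
    (trans (sym (S.U-window i<l l<i+n)) (trans (U≗ l)
      (S′.U-window (subst (λ i → suc i ≤ l) i≡ i<l) (subst (λ i → l < suc i + suc n′) i≡ l<i+n))))
    where
    i+k≤j = ≮⇒≥ j≮i+k
    l = j ∸ suc k′
    l+k≡j : l + suc k′ ≡ j
    l+k≡j = m∸n+n≡m (≤-trans (m≤n+m (suc k′) (suc S.i)) i+k≤j)
    i<l : suc S.i ≤ l
    i<l = +-cancelʳ-≤ (suc k′) (suc S.i) l (subst (suc S.i + suc k′ ≤_) (sym l+k≡j) i+k≤j)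
    l<i+n : l < suc S.i + suc n′
    l<i+n = +-cancelʳ-< (suc k′) l (suc S.i + suc n′)
      (subst₂ _<_ (sym l+k≡j) (sym (+-assoc (suc S.i) (suc n′) (suc k′))) j<i+N)

  W≗ : S.W ≗ S′.W
  W≗ = periodic-≗ (suc S.i) (n′ + suc k′) S.W-periodic S′.W-periodic window

-- Construction of the splitting at the first crossing

module _ (n′ k′ : ℕ) {W : ℕ → ℚ} (W-escher : EscherSequence W (suc n′ + suc k′)) where
  private
    n = suc n′
    k = suc k′
    Z : ℕ → ℚ
    Z j = W (j + k)

  Z-arrows : ∀ j → Z j ⟶ Z (suc j)
  Z-arrows j = arrows W-escher (j + k)

  -- As `Z` is `W` shifted by `k`, so `W` is `Z` shifted by `n`: the two play symmetric roles.
  Z-return : ∀ j → Z (j + n) ≡ W j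
  Z-return j = trans (cong W (+-assoc j n k)) (periodic W-escher j)

  first-crossing : ∃[ i ] Crossing W Z i × (∀ {j} → j < i → ¬ Crossing W Z j)
  first-crossing with first-witness (crossing? W Z) (suc ((n + k) * k))
  ... | inj₁ found = found
  -- The bound covers all `n + k` comparisons along the closed chain of steps of `k` from position
  -- `1`.
  ... | inj₂ none with dominates-either W Z (arrows W-escher) Z-arrows _ none
  ...   | inj₁ W>Z = ⊥-elim (chain-impossible ℚ._<_ ℚ.<-trans (ℚ.<-irrefl refl) k
                       (periodic W-escher) (λ j<B → proj₂ (W>Z j<B)))
  ...   | inj₂ Z>W = ⊥-elim (chain-impossible (flip ℚ._<_) (flip ℚ.<-trans) (ℚ.<-irrefl refl) k
                       (periodic W-escher) (λ j<B → proj₂ (Z>W j<B)))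

  separate-window : ∀ {b m a c} → m ≤ n + k → b ≤ a → a < c → c < b + m → W a ≢ W c
  separate-window {b} {m} {a} {c} m≤N b≤a a<c c<b+m eq =
    separate W-escher a (m<n⇒0<n∸m a<c) d<N (trans eq (cong W (sym (m+[n∸m]≡n (<⇒≤ a<c)))))
    where
    d<N : c ∸ a < n + k
    d<N = +-cancelˡ-< a (c ∸ a) (n + k) (subst (_< a + (n + k)) (sym (m+[n∸m]≡n (<⇒≤ a<c)))
      (≤-trans c<b+m (+-mono-≤ b≤a m≤N)))

  module _ {i} (crosses : Crossing W Z i) (none : ∀ {j} → j < i → ¬ Crossing W Z j) where

    U V : ℕ → ℚ
    U = periodize (suc i) n′ Z
    V = periodize (suc i) k′ W

    U-window : ∀ {j} → suc i ≤ j → j < suc i + n → U j ≡ Z j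
    U-window = periodize-window (suc i) n′ Z

    V-window : ∀ {j} → suc i ≤ j → j < suc i + k → V j ≡ W j
    V-window = periodize-window (suc i) k′ W

    U-escher : EscherSequence U n
    U-escher = periodize-escher (suc i) n′ Z (λ {j} _ _ → Z-arrows j)
      -- The last value is `Z (i + n)`, that is `W i`, so the closing arrow is the first half of the
      -- crossing.
      (subst (_⟶ Z (suc i)) (sym (trans (cong Z (sym (+-suc i n′))) (Z-return i))) (proj₁ crosses))
      (λ {_} {c} b≤a a<c c<b+n → separate-window {b = suc i + k} {m = n} (m≤m+n n k)
        (+-monoˡ-≤ k b≤a) (+-monoˡ-< k a<c)
        (subst (c + k <_) (solve 3 (λ i n k → i :+ n :+ k := i :+ k :+ n) refl (suc i) n k)
          (+-monoˡ-< k c<b+n)))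
      where open +-*-Solver

    V-escher : EscherSequence V k
    V-escher = periodize-escher (suc i) k′ W (λ {j} _ _ → arrows W-escher j)
      -- The last value is `W (i + k)`, that is `Z i`, so the closing arrow is the second half.
      (subst (λ x → W x ⟶ W (suc i)) (+-suc i k′) (proj₂ crosses))
      (separate-window (m≤n+m k n))

    Ui≡Wi : U i ≡ W i
    Ui≡Wi = trans (sym (periodic U-escher i))
      (trans (U-window (m<m+n i z<s) (n<1+n (i + n))) (Z-return i))

    Vi≡Zi : V i ≡ Z i
    Vi≡Zi = trans (sym (periodic V-escher i)) (V-window (m<m+n i z<s) (n<1+n (i + k)))

    -- At `i` the pair `U`, `V` agrees with `W`, `Z`, but at `suc i` with `Z`, `W`. This exchange
    -- makes the required arrows those inside `W` and inside `Z`.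
    crosses-UV : Crossing U V i
    crosses-UV =
        subst₂ _⟶_ (sym Ui≡Wi) (sym (V-window ≤-refl (m<m+n (suc i) z<s))) (arrows W-escher i)
      , subst₂ _⟶_ (sym Vi≡Zi) (sym (U-window ≤-refl (m<m+n (suc i) z<s))) (Z-arrows i)

    -- The hypothesis says that `W` descends under steps of `k` and, by `Z-return`, that `Z` ascends
    -- under steps of `n`; these give the bounds on `V` and on `U`. The order is a parameter so that
    -- it can be reversed when `Z` is above `W`.
    compare : (_≤′_ : Rel ℚ 0ℓ) → Reflexive _≤′_ → Transitive _≤′_ →
      (∀ {j} → j < i → Z (suc j) ≤′ W (suc j)) →
      ∀ {j} → j ≤ i → (W j ≤′ U j) × (V j ≤′ Z j)
    compare _≤′_ ≤′-refl ≤′-trans Z≤′W {j} j≤i =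
        subst (_≤′ U j) (Z-return j)
          (periodic-comparison (flip _≤′_) ≤′-refl (flip ≤′-trans) Z U i n′ (periodic U-escher) U-window
            (λ {j} j<i → subst (Z (suc j) ≤′_) (sym (Z-return (suc j))) (Z≤′W j<i)) j≤i)
      , periodic-comparison _≤′_ ≤′-refl ≤′-trans W V i k′ (periodic V-escher) V-window Z≤′W j≤i

    -- When `W` is above `Z`, up to `i` the sequence `U` is at least `W` and `V` at most `Z`, so an
    -- arrow from `U j` to `V (suc j)` would give the excluded one from `W j` to `Z (suc j)`. The
    -- other case is symmetric.
    first-UV : ∀ {j} → j < i → ¬ Crossing U V j
    first-UV {j} j<i (U⟶V , V⟶U) with dominates-either W Z (arrows W-escher) Z-arrows i none
    ... | inj₁ W>Z = proj₁ (W>Z j<i) (⟶-mono (proj₁ (bounds (<⇒≤ j<i))) U⟶V (proj₂ (bounds j<i)))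
      where
      bounds : ∀ {j} → j ≤ i → (W j ℚ.≤ U j) × (V j ℚ.≤ Z j)
      bounds = compare ℚ._≤_ ℚ.≤-refl ℚ.≤-trans (λ l<i → ℚ.<⇒≤ (proj₂ (W>Z l<i)))
    ... | inj₂ Z>W = proj₁ (Z>W j<i) (⟶-mono (proj₂ (bounds (<⇒≤ j<i))) V⟶U (proj₁ (bounds j<i)))
      where
      bounds : ∀ {j} → j ≤ i → (U j ℚ.≤ W j) × (Z j ℚ.≤ V j)
      bounds = compare (flip ℚ._≤_) ℚ.≤-refl (flip ℚ.≤-trans) (λ l<i → ℚ.<⇒≤ (proj₂ (Z>W l<i)))

    splitting : Splitting n′ k′ (applyUpTo W (n + k)) (applyUpTo U n) (applyUpTo V k)
    splitting = record
      { i = i ; w≡ = refl ; u≡ = refl ; v≡ = refl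
      ; W-periodic = periodic W-escher
      ; U-periodic = periodic U-escher
      ; V-periodic = periodic V-escher
      ; U-window = U-window ; V-window = V-window
      ; crosses = crosses-UV ; first = first-UV }

    split-sequence : ∀ (S : UIO) → (∀ j → W j ∈ elems S) →
      ∃[ uv ] uv ∈ cartesianProduct (P S n) (P S k)
            × Splitting n′ k′ (applyUpTo W (n + k)) (proj₁ uv) (proj₂ uv)
    split-sequence S W∈S = (applyUpTo U n , applyUpTo V k)
      , ∈-cartesianProduct⁺
          (∈-filter⁺ isEscher? (applyUpTo∈words U (λ _ → W∈S _) n) (sequence⇒escher n′ U-escher))
          (∈-filter⁺ isEscher? (applyUpTo∈words V (λ _ → W∈S _) k) (sequence⇒escher k′ V-escher))
      , splitting

split : ∀ (S : UIO) n′ k′ {w} → w ∈ P S (suc n′ + suc k′) →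
  ∃[ uv ] uv ∈ cartesianProduct (P S (suc n′)) (P S (suc k′))
        × Splitting n′ k′ w (proj₁ uv) (proj₂ uv)
split S n′ k′ w∈P
  with w∈words , escher ← ∈-filter⁻ isEscher? {xs = words (elems S) (suc n′ + suc k′)} w∈P
  with f , f∈S , refl ← word⇒applyUpTo {elems S} (suc n′ + suc k′) w∈words
  with W-escher ← escher⇒sequence (n′ + suc k′) f escher
  with i , crosses , none ← first-crossing n′ k′ W-escher
  with uv , uv∈ , s ← split-sequence n′ k′ W-escher crosses none S
                        -- Only values of `f` below `suc n′ + suc k′` are known to lie in `S`; the
                        -- periodization takes no others.
                        (λ j → f∈S (representative-upper 0 (n′ + suc k′) j)) =
    uv , uv∈ , subst (λ w → Splitting n′ k′ w (proj₁ uv) (proj₂ uv))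
      (applyUpTo-cong (suc n′ + suc k′) (periodize-window 0 (n′ + suc k′) f z≤n)) s

theorem4p1 : (n k : ℕ) → 1 ≤ k → k < n → (U : UIO) → length (elems U) ≡ n + k →
    #P U (n + k) ≤ #P U n * #P U k
theorem4p1 (suc n′) (suc k′) _ _ U _ =
  subst (#P U (suc n′ + suc k′) ≤_)
    (length-cartesianProduct (P U (suc n′)) (P U (suc k′)))
    (length-mono-relation (λ w uv → Splitting n′ k′ w (proj₁ uv) (proj₂ uv))
      (Unique.filter⁺ isEscher? (words-unique (distinct U) (suc n′ + suc k′)))
      (split U n′ k′) splitting-injective)
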